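{- For every integer $n \ge 1$, let $f(n)$ be the maximum, over all cyclic permutations $\pi$ of order $n$, of the minimum number of adjacent swaps needed to transform $\pi$ into the trivial cyclic permutation $u=(1,2,\ldots,n)$. Then \[ f(n) = \left\lfloor \frac{(n-1)^2}{4} \right\rfloor. \]
   Context: A cyclic permutation of order $n$ is a bijective labeling of the vertices of a cycle of length $n$ by the elements of $[n]=\{1,\ldots,n\}$, where two labelings that differ by a rotation of the cycle (a cyclic shift) are considered the same; reflections are not identified. An adjacent swap transforms a cyclic permutation into the one obtained by exchanging the labels of two vertices that are adjacent along the cycle. The trivial cyclic permutation $u=(1,2,\ldots,n)$ is the labeling in which the labels $1,2,\ldots,n$ appear consecutively around the cycle in this order. Equivalently, $f(n)$ is the diameter of the graph whose vertices are the cyclic permutations of order $n$, two being adjacent iff one is obtained from the other by a single adjacent swap. -}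

module Defs where

open import Data.Nat using (ℕ; zero; suc; _+_; _*_; _∸_; _≤_; NonZero)
open import Data.Nat.DivMod using (_mod_; _/_)
open import Data.Fin using (Fin; toℕ; _≟_)
open import Data.Fin.Permutation using (Permutation′; _⟨$⟩ʳ_)
open import Data.List using (List; []; _∷_; length)
open import Data.Product using (Σ; _×_)
open import Relation.Binary.PropositionalEquality using (_≡_)
open import Relation.Nullary using (yes; no)

-- A labelling of the n-cycle: position (Fin n, positions 0..n-1 in cyclic
-- order) ↦ label (Fin n, label i stands for i+1).
Arrangement : ℕ → Set
Arrangement n = Fin n → Fin n

next : {n : ℕ} .{{_ : NonZero n}} → Fin n → Fin n
next {n} p = suc (toℕ p) mod n

swapAt : {n : ℕ} .{{_ : NonZero n}} → Fin n → Arrangement n → Arrangement n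
swapAt i π p with p ≟ i
... | yes _ = π (next i)
... | no _ with p ≟ next i
...   | yes _ = π i
...   | no _ = π p

applySwaps : {n : ℕ} .{{_ : NonZero n}} → List (Fin n) → Arrangement n → Arrangement n
applySwaps [] π = π
applySwaps (i ∷ is) π = applySwaps is (swapAt i π)

rotU : {n : ℕ} .{{_ : NonZero n}} → ℕ → Arrangement n
rotU {n} r p = (toℕ p + r) mod n

-- π can be transformed into the trivial cyclic permutation u (i.e. into some
-- rotation of it) using at most k adjacent swaps
Within : {n : ℕ} .{{_ : NonZero n}} → ℕ → Arrangement n → Set
Within {n} k π =
  Σ (List (Fin n)) λ is → (length is ≤ k) ×
    Σ ℕ λ r → (∀ p → applySwaps is π p ≡ rotU r p)

bound : ℕ → ℕ
bound n = ((n ∸ 1) * (n ∸ 1)) / 4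

{-# OPTIONS --safe #-}
module Submission where

-- Lift the elements to the universal cover of the cycle and count, for each pair of
-- elements, the signed number of times they still have to cross.  A swap changes
-- this number for one pair only, and by one.
--
-- Upper bound.  Let every label x with pos x > x make one additional turn.  If some
-- neighbours still have to cross, swapping them lowers the total by one; if none do,
-- the arrangement is a rotation of u.  The initial total is the number of alignments
-- of the permutation, which is at most e (n - 1 - e), where e is the number of
-- excedances (Corteel), hence at most (n - 1)² / 4.
--
-- Lower bound.  Reversing the cyclic order forces the crossing number of x < y to be
-- of the form 1 + z x - z y, which is odd whenever z x and z y have the same parity.
-- So all pairs inside each of two classes have to cross, and
-- C(a, 2) + C(n - a, 2) ≥ ⌊(n - 1)² / 4⌋.

open import Defs
open import Data.Fin as Fin using (Fin; zero; suc; toℕ; fromℕ; inject₁; _≟_)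
import Data.Fin.Properties as Fin
open import Data.Fin.Induction using (<-weakInduction; >-weakInduction)
open import Data.Fin.Permutation using (Permutation′; _⟨$⟩ʳ_; _⟨$⟩ˡ_; _∘ₚ_; transpose; inverseˡ; inverseʳ; flip; id; reverse)
import Data.Fin.Permutation.Components as PC
open import Data.Fin.Relation.Unary.Top using (view; ‵fromℕ; ‵inject₁)
open import Data.Integer using (ℤ; +_; -[1+_]; 0ℤ; 1ℤ; _+_; _*_; -_; _-_; _^_; _<_; ∣_∣; +≤+; +<+; -≤+; NonNegative) renaming (_≤_ to _≤ᶻ_)
open import Data.Integer.Properties hiding (_≟_; _≤?_; _<?_)
import Data.Integer.Properties as ℤ
open import Data.Integer.Tactic.RingSolver using (solve-∀)
import Data.Nat.Tactic.RingSolver as ℕ-Solver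
open import Data.List using (List; []; _∷_; length)
open import Data.Nat as ℕ using (ℕ; zero; suc; s≤s; z≤n; _≤_; _≤?_; _<?_; NonZero)
import Data.Nat.Properties as ℕ
import Data.Nat.DivMod as ℕ
open import Data.Product using (Σ; _×_; _,_; ∃-syntax)
open import Data.Sum using (_⊎_; inj₁; inj₂; [_,_]′)
open import Function using (_∘_)
open import Relation.Binary.Definitions using (Tri; tri<; tri≈; tri>)
open import Relation.Binary.PropositionalEquality using (_≡_; _≢_; _≗_; refl; sym; trans; cong; cong₂; subst; subst₂; module ≡-Reasoning)
open import Relation.Nullary using (Dec; yes; no; ¬_; contradiction)
open import Algebra.Properties.Semiring.Sum +-*-semiring using (sum; sum-cong-≗; ∑-distrib-+; ∑-comm; ∑-permute; *-distribˡ-sum; *-distribʳ-sum)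

-- Finite integer sums and indicator functions.

sum-mono-≤ : ∀ {n} {f g : Fin n → ℤ} → (∀ x → f x ≤ᶻ g x) → sum f ≤ᶻ sum g
sum-mono-≤ {zero} f≤g = ≤-refl
sum-mono-≤ {suc n} f≤g = +-mono-≤ (f≤g zero) (sum-mono-≤ (f≤g ∘ suc))

sum-const : ∀ n c → sum {n} (λ _ → c) ≡ + n * c
sum-const zero c = refl
sum-const (suc n) c = trans (cong (_+_ c) (sum-const n c)) (distrib c (+ n))
  where
  distrib : ∀ c n → c + n * c ≡ (1ℤ + n) * c
  distrib = solve-∀

sum-zero : ∀ {n} (f : Fin n → ℤ) → (∀ x → f x ≡ 0ℤ) → sum f ≡ 0ℤ
sum-zero {n} f f≡0 = trans (sum-cong-≗ f≡0) (trans (sum-const n 0ℤ) (*-zeroʳ (+ n)))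

sum-distrib-- : ∀ {n} (f g : Fin n → ℤ) → sum (λ x → f x - g x) ≡ sum f - sum g
sum-distrib-- {zero} f g = refl
sum-distrib-- {suc n} f g = trans (cong (_+_ (f zero - g zero)) (sum-distrib-- (f ∘ suc) (g ∘ suc)))
  (ring (f zero) (g zero) (sum (f ∘ suc)) (sum (g ∘ suc)))
  where
  ring : ∀ a b c d → a - b + (c - d) ≡ a + c - (b + d)
  ring = solve-∀

-- A permutation only reorders the summands. This is what makes every row sum of `gain` vanish.
sum-rearrange : ∀ {n} (f : Fin n → ℤ) (π : Permutation′ n) → sum (λ y → f y - f (π ⟨$⟩ˡ y)) ≡ 0ℤ
sum-rearrange f π = trans (sum-distrib-- f (f ∘ (π ⟨$⟩ˡ_))) (i≡j⇒i-j≡0 (∑-permute f (flip π)))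

sum₂ : ∀ {n} → (Fin n → Fin n → ℤ) → ℤ
sum₂ f = sum (λ x → sum (f x))

sum₂-mono-≤ : ∀ {n} {f g : Fin n → Fin n → ℤ} → (∀ x y → f x y ≤ᶻ g x y) → sum₂ f ≤ᶻ sum₂ g
sum₂-mono-≤ f≤g = sum-mono-≤ (λ x → sum-mono-≤ (f≤g x))

sum₂-distrib-+ : ∀ {n} (f g : Fin n → Fin n → ℤ) →
  sum₂ (λ x y → f x y + g x y) ≡ sum₂ f + sum₂ g
sum₂-distrib-+ f g =
  trans (sum-cong-≗ (λ x → ∑-distrib-+ (f x) (g x))) (∑-distrib-+ (sum ∘ f) (sum ∘ g))

sum₂-* : ∀ {n} (f g : Fin n → ℤ) → sum₂ (λ x y → f x * g y) ≡ sum f * sum g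
sum₂-* f g = trans (sum-cong-≗ (λ x → sym (*-distribˡ-sum (f x) g)))
  (sym (*-distribʳ-sum (sum g) f))

𝟙 : ∀ {a} {P : Set a} → Dec P → ℤ
𝟙 (yes _) = 1ℤ
𝟙 (no _)  = 0ℤ

𝟙-true : ∀ {a} {P : Set a} (P? : Dec P) → P → 𝟙 P? ≡ 1ℤ
𝟙-true (yes _) p = refl
𝟙-true (no ¬p) p = contradiction p ¬p

𝟙-false : ∀ {a} {P : Set a} (P? : Dec P) → ¬ P → 𝟙 P? ≡ 0ℤ
𝟙-false (yes p) ¬p = contradiction p ¬p
𝟙-false (no _)  ¬p = refl

𝟙-cong : ∀ {a b} {P : Set a} {Q : Set b} (P? : Dec P) (Q? : Dec Q) → (P → Q) → (Q → P) → 𝟙 P? ≡ 𝟙 Q?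
𝟙-cong (yes p) Q? f g = sym (𝟙-true Q? (f p))
𝟙-cong (no ¬p) Q? f g = sym (𝟙-false Q? (¬p ∘ g))

δ : ∀ {n} → Fin n → Fin n → ℤ
δ x y = 𝟙 (x ≟ y)

sum-δ : ∀ {n} (y : Fin n) → sum (λ x → δ x y) ≡ 1ℤ
sum-δ {suc n} zero = cong (_+_ 1ℤ) (sum-zero {n} (λ _ → 0ℤ) (λ _ → refl))
sum-δ (suc y) = trans (+-identityˡ _)
  (trans (sum-cong-≗ (λ x → 𝟙-cong (suc x ≟ suc y) (x ≟ y) Fin.suc-injective (cong suc))) (sum-δ y))

sum₂-δ : ∀ {n} (a b : Fin n) → sum₂ (λ x y → δ x a * δ y b) ≡ 1ℤ
sum₂-δ a b = trans (sum₂-* (λ x → δ x a) (λ y → δ y b)) (cong₂ _*_ (sum-δ a) (sum-δ b))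

-- Order of positions on the cut cycle, and how a swap changes it.

infix 7 _≻_
_≻_ : ∀ {n} → Fin n → Fin n → ℤ
p ≻ q = 𝟙 (q Fin.<? p)

≻-irrefl : ∀ {n} (p : Fin n) → p ≻ p ≡ 0ℤ
≻-irrefl p = 𝟙-false (p Fin.<? p) (ℕ.<-irrefl refl)

toℕ-≢ : ∀ {n} {p q : Fin n} → p ≢ q → toℕ p ≢ toℕ q
toℕ-≢ p≢q e = p≢q (Fin.toℕ-injective e)

next-inject₁ : ∀ {m} (j : Fin m) → next (inject₁ j) ≡ suc j
next-inject₁ {m} j = Fin.toℕ-injective (trans (Fin.toℕ-fromℕ< _)
  (trans (cong (λ k → suc k ℕ.% suc m) (Fin.toℕ-inject₁ j)) (ℕ.m<n⇒m%n≡m (s≤s (Fin.toℕ<n j)))))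

next-fromℕ : ∀ m → next (fromℕ m) ≡ zero
next-fromℕ m = Fin.toℕ-injective (trans (Fin.toℕ-fromℕ< _)
  (trans (cong (λ k → suc k ℕ.% suc m) (Fin.toℕ-fromℕ m)) (ℕ.n%n≡0 (suc m))))

-- The change of winding number of an element at position p when the elements at
-- positions i and next i are exchanged: nonzero only across the cut of the cycle.
turn : ∀ {m} → Fin (suc m) → Fin (suc m) → ℤ
turn {m} i p = 𝟙 (i ≟ fromℕ m) * (δ p i - δ p (next i))

-- Tabulates a position before and after the exchange together with its two indicators, so that a
-- statement about two positions splits into nine closed computations.
data Transposed {n} (i i′ : Fin n) : Fin n → Fin n → ℤ → ℤ → Set where
  left  : Transposed i i′ i i′ 1ℤ 0ℤ
  right : Transposed i i′ i′ i 0ℤ 1ℤ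
  fixed : ∀ {p} → p ≢ i → p ≢ i′ → Transposed i i′ p p 0ℤ 0ℤ

transposed : ∀ {n} {i i′ : Fin n} → i ≢ i′ → ∀ p →
  Transposed i i′ p (PC.transpose i′ i p) (δ p i) (δ p i′)
transposed {i = i} {i′} i≢i′ p with p ≟ i′
... | yes refl rewrite 𝟙-false (i′ ≟ i) (i≢i′ ∘ sym) = right
... | no p≢i′ with p ≟ i
...   | yes refl = left
...   | no p≢i = fixed p≢i p≢i′

-- Treats both kinds of swap at once: `a` is 0 for a swap away from the cut and 1 for the swap
-- across it. The three hypotheses describe how the comparisons of `i` and `i′` with each other and
-- with a third position differ.
≻-transpose : ∀ {n} {i i′ : Fin n} (a : ℤ) →
  i′ ≻ i + (a + a) ≡ i ≻ i′ + 1ℤ →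
  (∀ q → q ≢ i → q ≢ i′ → i′ ≻ q + a ≡ i ≻ q) →
  (∀ q → q ≢ i → q ≢ i′ → q ≻ i′ ≡ q ≻ i + a) →
  ∀ {p p′ q q′ d d′ e e′} → Transposed i i′ p p′ d d′ → Transposed i i′ q q′ e e′ →
  p′ ≻ q′ + (a * (d - d′) - a * (e - e′)) ≡ p ≻ q + (d * e′ - d′ * e)
≻-transpose {i = i} {i′} a pair below above = go
  where
  ring₁ : ∀ a d → a * d - a * d ≡ 0ℤ
  ring₁ = solve-∀
  ring₂ : ∀ b a → b + (a * 1ℤ - a * - 1ℤ) ≡ b + (a + a)
  ring₂ = solve-∀
  ring₃ : ∀ b a → b + (a * 1ℤ - a * 0ℤ) ≡ b + a
  ring₃ = solve-∀
  ring₄ : ∀ b a → b + (a * - 1ℤ - a * 1ℤ) ≡ b + 1ℤ - (a + a + 1ℤ)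
  ring₄ = solve-∀
  ring₅ : ∀ b a → b + (a + a) - (a + a + 1ℤ) ≡ b + - 1ℤ
  ring₅ = solve-∀
  ring₆ : ∀ b a → b + a + (a * - 1ℤ - a * 0ℤ) ≡ b + 0ℤ
  ring₆ = solve-∀
  ring₇ : ∀ b a → b + a + (a * 0ℤ - a * 1ℤ) ≡ b + 0ℤ
  ring₇ = solve-∀
  ring₈ : ∀ b a → b + (a * 0ℤ - a * - 1ℤ) ≡ b + a + 0ℤ
  ring₈ = solve-∀

  go : ∀ {p p′ q q′ d d′ e e′} → Transposed i i′ p p′ d d′ → Transposed i i′ q q′ e e′ →
    p′ ≻ q′ + (a * (d - d′) - a * (e - e′)) ≡ p ≻ q + (d * e′ - d′ * e)
  go left left = cong₂ _+_ (trans (≻-irrefl i′) (sym (≻-irrefl i))) (ring₁ a 1ℤ)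
  go left right = trans (ring₂ (i′ ≻ i) a) pair
  go left (fixed {q} q≢i q≢i′) =
    trans (ring₃ (i′ ≻ q) a) (trans (below q q≢i q≢i′) (sym (+-identityʳ _)))
  go right left =
    trans (ring₄ (i ≻ i′) a) (trans (cong (_- (a + a + 1ℤ)) (sym pair)) (ring₅ (i′ ≻ i) a))
  go right right = cong₂ _+_ (trans (≻-irrefl i) (sym (≻-irrefl i′))) (ring₁ a (- 1ℤ))
  go right (fixed {q} q≢i q≢i′) =
    trans (cong (_+ (a * - 1ℤ - a * 0ℤ)) (sym (below q q≢i q≢i′))) (ring₆ (i′ ≻ q) a)
  go (fixed {p} p≢i p≢i′) left =
    trans (cong (_+ (a * 0ℤ - a * 1ℤ)) (above p p≢i p≢i′)) (ring₇ (p ≻ i) a)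
  go (fixed {p} p≢i p≢i′) right =
    trans (ring₈ (p ≻ i) a) (sym (cong (_+ 0ℤ) (above p p≢i p≢i′)))
  go (fixed {p} _ _) (fixed {q} _ _) = cong (_+_ (p ≻ q)) (ring₁ a 0ℤ)

-- A swap across the cut reverses the comparison of the moved elements with all others; the `turn`
-- terms compensate for this, and only the swapped pair retains a change. `transpose` has `next i`
-- first because positions move by the inverse permutation.
≻-swap : ∀ {m} (i p q : Fin (suc m)) →
  PC.transpose (next i) i p ≻ PC.transpose (next i) i q + (turn i p - turn i q)
    ≡ p ≻ q + (δ p i * δ q (next i) - δ p (next i) * δ q i)
≻-swap {m} i p q with view i
≻-swap {zero} _ zero zero | ‵fromℕ = refl
≻-swap {m@(suc m′)} _ p q | ‵fromℕ
  rewrite next-fromℕ m | 𝟙-true (fromℕ m ≟ fromℕ m) refl =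
  ≻-transpose 1ℤ (cong (_+ 1ℤ) (sym (𝟙-true (zero {n = m} Fin.<? fromℕ m) (s≤s z≤n))))
    (λ q q≢i _ → sym (𝟙-true (q Fin.<? fromℕ m)
      (ℕ.≤∧≢⇒< (Fin.≤fromℕ q) (toℕ-≢ q≢i))))
    (λ q _ q≢0 → trans (𝟙-true (zero {n = m} Fin.<? q) (ℕ.≤∧≢⇒< z≤n (toℕ-≢ (q≢0 ∘ sym))))
      (cong (_+ 1ℤ) (sym (𝟙-false (fromℕ m Fin.<? q) (ℕ.≤⇒≯ (Fin.≤fromℕ q))))))
    (transposed (λ ()) p) (transposed (λ ()) q)
≻-swap {m} _ p q | ‵inject₁ j
  rewrite next-inject₁ j | 𝟙-false (inject₁ j ≟ fromℕ m) (Fin.fromℕ≢inject₁ ∘ sym) =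
  ≻-transpose 0ℤ
    (trans (cong (_+ 0ℤ) (𝟙-true (inject₁ j Fin.<? suc j) j<1+j))
      (sym (cong (_+ 1ℤ) (𝟙-false (suc j Fin.<? inject₁ j) (ℕ.<-asym j<1+j)))))
    (λ q q≢i _ → trans (+-identityʳ _) (𝟙-cong (q Fin.<? suc j) (q Fin.<? inject₁ j)
      (λ q<1+j → ℕ.≤∧≢⇒< (subst (toℕ q ℕ.≤_) (sym j≡) (ℕ.s≤s⁻¹ q<1+j)) (toℕ-≢ q≢i))
      (λ q<j → ℕ.<-trans q<j j<1+j)))
    (λ q _ q≢i′ → trans (𝟙-cong (suc j Fin.<? q) (inject₁ j Fin.<? q)
      (ℕ.<-trans j<1+j)
      (λ j<q → ℕ.≤∧≢⇒< (subst (λ k → suc k ℕ.≤ toℕ q) j≡ j<q) (toℕ-≢ (q≢i′ ∘ sym)))) (sym (+-identityʳ _)))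
    (transposed j≢ p) (transposed j≢ q)
  where
  j≡ : toℕ (inject₁ j) ≡ toℕ j
  j≡ = Fin.toℕ-inject₁ j
  j<1+j : toℕ (inject₁ j) ℕ.< toℕ (suc j)
  j<1+j = s≤s (ℕ.≤-reflexive j≡)
  j≢ : inject₁ j ≢ suc j
  j≢ e = ℕ.<⇒≢ j<1+j (cong toℕ e)

-- Swaps as transpositions, winding states and crossing numbers.

swapAt-cong : ∀ {m} (i : Fin (suc m)) {f g : Arrangement (suc m)} → f ≗ g → swapAt i f ≗ swapAt i g
swapAt-cong i f≗g p with p ≟ i
... | yes _ = f≗g (next i)
... | no _ with p ≟ next i
...   | yes _ = f≗g i
...   | no _ = f≗g p

applySwaps-cong : ∀ {m} (is : List (Fin (suc m))) {f g : Arrangement (suc m)} →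
  f ≗ g → applySwaps is f ≗ applySwaps is g
applySwaps-cong [] f≗g = f≗g
applySwaps-cong (i ∷ is) f≗g = applySwaps-cong is (swapAt-cong i f≗g)

swapAt≗transpose : ∀ {m} (i : Fin (suc m)) (f : Arrangement (suc m)) →
  swapAt i f ≗ f ∘ PC.transpose i (next i)
swapAt≗transpose i f p with p ≟ i
... | yes _ = refl
... | no _ with p ≟ next i
...   | yes _ = refl
...   | no _ = refl

-- Element x lies at pos x + n * lift x on the universal cover of the n-cycle, where
-- n = suc m.  cross x y is the signed number of times x has overtaken y, relative to
-- the state in which every x lies at x.  In total each pair is counted twice.
record Winding (m : ℕ) : Set where
  constructor winding
  field
    perm : Permutation′ (suc m)
    lift : Fin (suc m) → ℤ

  at : Fin (suc m) → Fin (suc m)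
  at = perm ⟨$⟩ʳ_

  pos : Fin (suc m) → Fin (suc m)
  pos = perm ⟨$⟩ˡ_

  cross : Fin (suc m) → Fin (suc m) → ℤ
  cross x y = lift x - lift y + (pos x ≻ pos y - x ≻ y)

  total : ℤ
  total = sum₂ (λ x y → + ∣ cross x y ∣)

open Winding

≻-antisym : ∀ {n} {p q : Fin n} → p ≢ q → q ≻ p ≡ 1ℤ - p ≻ q
≻-antisym {p = p} {q} p≢q with q Fin.<? p
... | yes q<p = 𝟙-false (p Fin.<? q) (ℕ.<-asym q<p)
... | no q≮p = 𝟙-true (p Fin.<? q) (ℕ.≤∧≢⇒< (ℕ.≮⇒≥ q≮p) (toℕ-≢ p≢q))

at-injective : ∀ {m} (s : Winding m) {p q} → at s p ≡ at s q → p ≡ q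
at-injective s e = trans (sym (inverseˡ (perm s))) (trans (cong (pos s) e) (inverseˡ (perm s)))

pos-injective : ∀ {m} (s : Winding m) {x y} → pos s x ≡ pos s y → x ≡ y
pos-injective s e = trans (sym (inverseʳ (perm s))) (trans (cong (at s) e) (inverseʳ (perm s)))

cross-irrefl : ∀ {m} (s : Winding m) x → cross s x x ≡ 0ℤ
cross-irrefl s x = trans
  (cong₂ (λ a b → lift s x - lift s x + (a - b)) (≻-irrefl (pos s x)) (≻-irrefl x))
  (ring (lift s x))
  where
  ring : ∀ a → a - a + 0ℤ ≡ 0ℤ
  ring = solve-∀

cross-antisym : ∀ {m} (s : Winding m) x y → cross s y x ≡ - cross s x y
cross-antisym s x y with x ≟ y
... | yes refl = trans (cross-irrefl s x) (cong -_ (sym (cross-irrefl s x)))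
... | no x≢y = trans
  (cong₂ (λ a b → lift s y - lift s x + (a - b)) (≻-antisym (x≢y ∘ pos-injective s)) (≻-antisym x≢y))
  (ring (lift s x) (lift s y) (pos s x ≻ pos s y) (x ≻ y))
  where
  ring : ∀ a b c d → b - a + (1ℤ - c - (1ℤ - d)) ≡ - (a - b + (c - d))
  ring = solve-∀

-- Effect of a swap on the crossing numbers and their total.

δ*δ : ∀ {n} (x a y b : Fin n) →
  (x ≡ a × y ≡ b × δ x a * δ y b ≡ 1ℤ) ⊎ δ x a * δ y b ≡ 0ℤ
δ*δ x a y b with x ≟ a | y ≟ b
... | yes x≡a | yes y≡b = inj₁ (x≡a , y≡b , refl)
... | yes _   | no _    = inj₂ refl
... | no _    | _       = inj₂ refl

∣i+j-k∣≤∣i∣+j+k : ∀ i {j k} → 0ℤ ≤ᶻ j → 0ℤ ≤ᶻ k → + ∣ i + (j - k) ∣ ≤ᶻ + ∣ i ∣ + (j + k)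
∣i+j-k∣≤∣i∣+j+k i {+ j} {+ k} _ _ = +≤+ (ℕ.≤-trans (∣i+j∣≤∣i∣+∣j∣ i (+ j - + k))
  (ℕ.+-monoʳ-≤ ∣ i ∣ (∣i-j∣≤∣i∣+∣j∣ (+ j) (+ k))))

-- A unit step towards zero lowers the absolute value by one; the sign conditions rule out `j` and
-- `k` both being 1.
∣i+j-k∣+j+k≤∣i∣ : ∀ {i j k} → (j ≡ 1ℤ × i < 0ℤ) ⊎ j ≡ 0ℤ → (k ≡ 1ℤ × 0ℤ < i) ⊎ k ≡ 0ℤ →
  + ∣ i + (j - k) ∣ + (j + k) ≤ᶻ + ∣ i ∣
∣i+j-k∣+j+k≤∣i∣ (inj₁ (refl , i<0)) (inj₁ (refl , 0<i)) = contradiction i<0 (<-asym 0<i)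
∣i+j-k∣+j+k≤∣i∣ { -[1+ zero ]} (inj₁ (refl , _)) (inj₂ refl) = ≤-refl
∣i+j-k∣+j+k≤∣i∣ { -[1+ suc k ]} (inj₁ (refl , _)) (inj₂ refl) =
  ≤-reflexive (cong +_ (ℕ.+-comm (suc k) 1))
∣i+j-k∣+j+k≤∣i∣ {+ _} (inj₁ (refl , +<+ ())) (inj₂ refl)
∣i+j-k∣+j+k≤∣i∣ {+ suc k} (inj₂ refl) (inj₁ (refl , _)) =
  ≤-reflexive (cong +_ (ℕ.+-comm k 1))
∣i+j-k∣+j+k≤∣i∣ {+ zero} (inj₂ refl) (inj₁ (refl , +<+ ()))
∣i+j-k∣+j+k≤∣i∣ {i} (inj₂ refl) (inj₂ refl) =
  ≤-reflexive (trans (+-identityʳ _) (cong (λ k → + ∣ k ∣) (+-identityʳ i)))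

module _ {m : ℕ} (s : Winding m) (i : Fin (suc m)) where

  private
    x₀ y₀ : Fin (suc m)
    x₀ = at s i
    y₀ = at s (next i)

    δ-at : ∀ x j → δ (pos s x) j ≡ δ x (at s j)
    δ-at x j = 𝟙-cong (pos s x ≟ j) (x ≟ at s j)
      (λ e → trans (sym (inverseʳ (perm s))) (cong (at s) e))
      (λ e → trans (cong (pos s) e) (inverseˡ (perm s)))

  swap : Winding m
  swap = winding (transpose i (next i) ∘ₚ perm s) (λ x → lift s x + turn i (pos s x))

  cross-swap : ∀ x y → cross swap x y ≡ cross s x y + (δ x x₀ * δ y y₀ - δ x y₀ * δ y x₀)
  cross-swap x y = begin
    lift s x + tx - (lift s y + ty) + (pos swap x ≻ pos swap y - x ≻ y)
      ≡⟨ ring (lift s x) (lift s y) tx ty (pos swap x ≻ pos swap y) (x ≻ y) ⟩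
    lift s x - lift s y + (pos swap x ≻ pos swap y + (tx - ty) - x ≻ y)
      ≡⟨ cong (λ k → lift s x - lift s y + (k - x ≻ y)) (≻-swap i (pos s x) (pos s y)) ⟩
    lift s x - lift s y + (pos s x ≻ pos s y + (δ (pos s x) i * δ (pos s y) (next i) - δ (pos s x) (next i) * δ (pos s y) i) - x ≻ y)
      ≡⟨ cong₂ (λ k l → lift s x - lift s y + (pos s x ≻ pos s y + (k - l) - x ≻ y))
           (cong₂ _*_ (δ-at x i) (δ-at y (next i))) (cong₂ _*_ (δ-at x (next i)) (δ-at y i)) ⟩
    lift s x - lift s y + (pos s x ≻ pos s y + (δ x x₀ * δ y y₀ - δ x y₀ * δ y x₀) - x ≻ y)
      ≡⟨ ring′ (lift s x - lift s y) (pos s x ≻ pos s y) _ (x ≻ y) ⟩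
    cross s x y + (δ x x₀ * δ y y₀ - δ x y₀ * δ y x₀) ∎
    where
    open ≡-Reasoning
    tx ty : ℤ
    tx = turn i (pos s x)
    ty = turn i (pos s y)
    ring : ∀ a b c d e f → a + c - (b + d) + (e - f) ≡ a - b + (e + (c - d) - f)
    ring = solve-∀
    ring′ : ∀ a b c d → a + (b + c - d) ≡ a + (b - d) + c
    ring′ = solve-∀

  private
    -- Supported on the two orders of the swapped pair, hence of sum 2: `total` counts every pair
    -- twice.
    D : Fin (suc m) → Fin (suc m) → ℤ
    D x y = δ x x₀ * δ y y₀ + δ x y₀ * δ y x₀

    sum₂-D : sum₂ D ≡ + 2
    sum₂-D = trans (sum₂-distrib-+ (λ x y → δ x x₀ * δ y y₀) (λ x y → δ x y₀ * δ y x₀))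
      (cong₂ _+_ (sum₂-δ x₀ y₀) (sum₂-δ y₀ x₀))

  total-swap-≤ : total swap ≤ᶻ total s + + 2
  total-swap-≤ = ≤-trans (sum₂-mono-≤ pointwise) (≤-reflexive (trans
    (sum₂-distrib-+ (λ x y → + ∣ cross s x y ∣) D) (cong (_+_ (total s)) sum₂-D)))
    where
    0≤δ*δ : ∀ (x a y b : Fin (suc m)) → 0ℤ ≤ᶻ δ x a * δ y b
    0≤δ*δ x a y b with δ*δ x a y b
    ... | inj₁ (_ , _ , e) = ≤-trans (+≤+ z≤n) (≤-reflexive (sym e))
    ... | inj₂ e           = ≤-reflexive (sym e)
    pointwise : ∀ x y → + ∣ cross swap x y ∣ ≤ᶻ + ∣ cross s x y ∣ + D x y
    pointwise x y = subst (λ c → + ∣ c ∣ ≤ᶻ + ∣ cross s x y ∣ + D x y) (sym (cross-swap x y))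
      (∣i+j-k∣≤∣i∣+j+k (cross s x y) (0≤δ*δ x x₀ y y₀) (0≤δ*δ x y₀ y x₀))

  -- The swap lets `x₀` overtake `y₀`, which moves the negative crossing number, and its positive
  -- mirror image, one step towards zero.
  total-swap-descent : cross s x₀ y₀ < 0ℤ → total swap + + 2 ≤ᶻ total s
  total-swap-descent c<0 = ≤-trans (≤-reflexive (sym (trans
    (sum₂-distrib-+ (λ x y → + ∣ cross swap x y ∣) D) (cong (_+_ (total swap)) sum₂-D))))
    (sum₂-mono-≤ pointwise)
    where
    0<cross : 0ℤ < cross s y₀ x₀
    0<cross = subst (0ℤ <_) (sym (cross-antisym s x₀ y₀)) (neg-mono-< c<0)
    forward : ∀ x y → (δ x x₀ * δ y y₀ ≡ 1ℤ × cross s x y < 0ℤ) ⊎ δ x x₀ * δ y y₀ ≡ 0ℤ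
    forward x y with δ*δ x x₀ y y₀
    ... | inj₁ (refl , refl , e) = inj₁ (e , c<0)
    ... | inj₂ e                 = inj₂ e
    backward : ∀ x y → (δ x y₀ * δ y x₀ ≡ 1ℤ × 0ℤ < cross s x y) ⊎ δ x y₀ * δ y x₀ ≡ 0ℤ
    backward x y with δ*δ x y₀ y x₀
    ... | inj₁ (refl , refl , e) = inj₁ (e , 0<cross)
    ... | inj₂ e                 = inj₂ e
    pointwise : ∀ x y → + ∣ cross swap x y ∣ + D x y ≤ᶻ + ∣ cross s x y ∣
    pointwise x y = subst (λ c → + ∣ c ∣ + D x y ≤ᶻ + ∣ cross s x y ∣) (sym (cross-swap x y))
      (∣i+j-k∣+j+k≤∣i∣ (forward x y) (backward x y))

-- States without descents are rotations.

≤-by-difference : ∀ {i j k l} → i ≤ᶻ j → j - i ≡ l - k → k ≤ᶻ l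
≤-by-difference i≤j e = 0≤i-j⇒j≤i (subst (0ℤ ≤ᶻ_) e (i≤j⇒0≤j-i i≤j))

-- If `y < x` then `d` is at least 1, and a full turn outweighs any label; otherwise `x < y` and `d`
-- is at least 0.
label-gap : ∀ {n} {x y : Fin n} {d} → x ≢ y → x ≻ y ≤ᶻ d → + toℕ x + 1ℤ ≤ᶻ + toℕ y + + n * d
label-gap {n} {x} {y} {d} x≢y b≤d with y Fin.<? x
... | yes _ = begin
  + toℕ x + 1ℤ ≡⟨ +-comm (+ toℕ x) 1ℤ ⟩
  + suc (toℕ x) ≤⟨ +≤+ (Fin.toℕ<n x) ⟩
  + n ≡⟨ *-identityʳ (+ n) ⟨
  + n * 1ℤ ≤⟨ *-monoˡ-≤-nonNeg (+ n) b≤d ⟩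
  + n * d ≤⟨ i≤j+i _ (+ toℕ y) ⟩
  + toℕ y + + n * d ∎
  where open ≤-Reasoning
... | no y≮x = begin
  + toℕ x + 1ℤ ≡⟨ +-comm (+ toℕ x) 1ℤ ⟩
  + suc (toℕ x) ≤⟨ +≤+ (ℕ.≤∧≢⇒< (ℕ.≮⇒≥ y≮x) (toℕ-≢ x≢y)) ⟩
  + toℕ y ≡⟨ trans (cong (_+_ (+ toℕ y)) (*-zeroʳ (+ n))) (+-identityʳ _) ⟨
  + toℕ y + + n * 0ℤ ≤⟨ +-monoʳ-≤ (+ toℕ y) (*-monoˡ-≤-nonNeg (+ n) b≤d) ⟩
  + toℕ y + + n * d ∎
  where open ≤-Reasoning

-- There are `m` steps of at least 1 and a total rise of at most `m`, so every step is exactly 1.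
-- The lower bound is propagated from the first position, the upper bound from the last.
tight-increasing : ∀ {m} (u : Fin (suc m) → ℤ) →
  (∀ j → u (inject₁ j) + 1ℤ ≤ᶻ u (suc j)) → u (fromℕ m) ≤ᶻ u zero + + m →
  ∀ p → u p ≡ u zero + + toℕ p
tight-increasing {m} u incr last p = ≤-antisym upper lower
  where
  open ≤-Reasoning
  assoc : ∀ a b → a + (1ℤ + b) ≡ a + b + 1ℤ
  assoc = solve-∀
  lower : u zero + + toℕ p ≤ᶻ u p
  lower = <-weakInduction (λ q → u zero + + toℕ q ≤ᶻ u q) (≤-reflexive (+-identityʳ _))
    (λ j ih → begin
      u zero + + suc (toℕ j) ≡⟨ assoc (u zero) (+ toℕ j) ⟩
      u zero + + toℕ j + 1ℤ ≡⟨ cong (λ k → u zero + + k + 1ℤ) (Fin.toℕ-inject₁ j) ⟨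
      u zero + + toℕ (inject₁ j) + 1ℤ ≤⟨ +-monoˡ-≤ 1ℤ ih ⟩
      u (inject₁ j) + 1ℤ ≤⟨ incr j ⟩
      u (suc j) ∎) p
  upper : u p ≤ᶻ u zero + + toℕ p
  upper = >-weakInduction (λ q → u q ≤ᶻ u zero + + toℕ q)
    (≤-trans last (≤-reflexive (cong (λ k → u zero + + k) (sym (Fin.toℕ-fromℕ m)))))
    (λ j ih → ≤-by-difference
      (≤-trans (incr j) (≤-trans ih (≤-reflexive (trans (assoc (u zero) (+ toℕ j)) (cong (λ k → u zero + + k + 1ℤ) (sym (Fin.toℕ-inject₁ j)))))))
      (cancel (u (inject₁ j)) (u zero + + toℕ (inject₁ j)))) p
    where
    cancel : ∀ a b → b + 1ℤ - (a + 1ℤ) ≡ b - a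
    cancel = solve-∀

cross-at : ∀ {m} (s : Winding m) p q →
  cross s (at s p) (at s q) ≡ lift s (at s p) - lift s (at s q) + (p ≻ q - at s p ≻ at s q)
cross-at s p q = cong₂ (λ a b → lift s (at s p) - lift s (at s q) + (a ≻ b - at s p ≻ at s q))
  (inverseˡ (perm s)) (inverseˡ (perm s))

≡-mod : ∀ {n} .{{_ : ℕ.NonZero n}} (x : Fin n) (a : ℕ) (z : ℤ) → + toℕ x + + n * z ≡ + a → x ≡ a ℕ.mod n
≡-mod {n} x a z e = Fin.toℕ-injective (sym (trans (Fin.toℕ-fromℕ< _) (trans (go z e) (ℕ.m<n⇒m%n≡m (Fin.toℕ<n x)))))
  where
  go : ∀ z → + toℕ x + + n * z ≡ + a → a ℕ.% n ≡ toℕ x ℕ.% n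
  go (+ k) e = trans (cong (ℕ._% n) (sym (+-injective (trans (cong (_+_ (+ toℕ x)) (trans (pos-* k n) (*-comm (+ k) (+ n)))) e))))
    (ℕ.[m+kn]%n≡m%n (toℕ x) k n)
  go -[1+ k ] e = trans (sym (ℕ.[m+kn]%n≡m%n a (suc k) n)) (cong (ℕ._% n) (sym (+-injective (begin
    + toℕ x ≡⟨ ring (+ toℕ x) (+ n) (+ suc k) ⟩
    + toℕ x + + n * -[1+ k ] + + suc k * + n ≡⟨ cong₂ _+_ e (sym (pos-* (suc k) n)) ⟩
    + a + + (suc k ℕ.* n) ∎))))
    where
    open ≡-Reasoning
    ring : ∀ x n k → x ≡ x + n * (- k) + k * n
    ring = solve-∀

-- The numbers `u p`, label minus `N` times lift, rise by at least 1 from each position to the next,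
-- and the pair across the cut limits the total rise to `m`. By `tight-increasing` the labels are
-- then consecutive modulo `N`.
sorted⇒rotation : ∀ {m} (s : Winding m) → (∀ i → 0ℤ ≤ᶻ cross s (at s i) (at s (next i))) →
  ∃[ r ] (∀ p → at s p ≡ rotU r p)
sorted⇒rotation {zero} s _ = 0 , λ p → Fin1 (at s p) (rotU 0 p)
  where
  Fin1 : (p q : Fin 1) → p ≡ q
  Fin1 zero zero = refl
sorted⇒rotation {m@(suc m′)} s sorted = toℕ (at s zero) , λ p →
  ≡-mod (at s p) (toℕ p ℕ.+ toℕ (at s zero)) (l zero - l p)
    (trans (ring₁ (+ toℕ (at s p)) N (l zero) (l p)) (trans (cong (_+ N * l zero) (tight-increasing u incr last p))
      (ring₂ (+ toℕ (at s zero)) (N * l zero) (+ toℕ p))))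
  where
  N : ℤ
  N = + suc m
  l u : Fin (suc m) → ℤ
  l p = lift s (at s p)
  u p = + toℕ (at s p) - N * l p
  ring₁ : ∀ x n a b → x + n * (a - b) ≡ x - n * b + n * a
  ring₁ = solve-∀
  ring₂ : ∀ x a p → x - a + p + a ≡ p + x
  ring₂ = solve-∀
  gap : ∀ p q → p ≢ q → 0ℤ ≤ᶻ cross s (at s p) (at s q) → u p + 1ℤ ≤ᶻ u q + N * (p ≻ q)
  gap p q p≢q 0≤c = ≤-by-difference
    (label-gap {d = l p - l q + p ≻ q} (p≢q ∘ at-injective s)
      (≤-by-difference (subst (0ℤ ≤ᶻ_) (cross-at s p q) 0≤c) (ring (l p) (l q) (p ≻ q) (at s p ≻ at s q))))
    (ring′ (+ toℕ (at s p)) (+ toℕ (at s q)) N (l p) (l q) (p ≻ q))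
    where
    ring : ∀ a b c d → a - b + (c - d) - 0ℤ ≡ a - b + c - d
    ring = solve-∀
    ring′ : ∀ x y n a b c → y + n * (a - b + c) - (x + 1ℤ) ≡ y - n * b + n * c - (x - n * a + 1ℤ)
    ring′ = solve-∀
  incr : ∀ j → u (inject₁ j) + 1ℤ ≤ᶻ u (suc j)
  incr j = ≤-trans (gap (inject₁ j) (suc j) (λ e → ℕ.<⇒≢ j<1+j (cong toℕ e))
      (subst (λ q → 0ℤ ≤ᶻ cross s (at s (inject₁ j)) (at s q)) (next-inject₁ j) (sorted (inject₁ j))))
    (≤-reflexive (trans (cong (λ b → u (suc j) + N * b) (𝟙-false (suc j Fin.<? inject₁ j) (ℕ.<-asym j<1+j)))
      (trans (cong (_+_ (u (suc j))) (*-zeroʳ N)) (+-identityʳ _))))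
    where
    j<1+j : toℕ (inject₁ j) ℕ.< toℕ (suc j)
    j<1+j = s≤s (ℕ.≤-reflexive (Fin.toℕ-inject₁ j))
  last : u (fromℕ m) ≤ᶻ u zero + + m
  last = ≤-by-difference (≤-trans (gap (fromℕ m) zero (λ ())
      (subst (λ q → 0ℤ ≤ᶻ cross s (at s (fromℕ m)) (at s q)) (next-fromℕ m) (sorted (fromℕ m))))
    (≤-reflexive (trans (cong (λ b → u zero + N * b) (𝟙-true (zero {n = m} Fin.<? fromℕ m) (s≤s z≤n)))
      (cong (_+_ (u zero)) (*-identityʳ N))))) (ring (u (fromℕ m)) (u zero) (+ m))
    where
    ring : ∀ a b c → b + (1ℤ + c) - (a + 1ℤ) ≡ b + c - a
    ring = solve-∀

-- Sorting by descents.

0≤total : ∀ {m} (s : Winding m) → 0ℤ ≤ᶻ total s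
0≤total {m} s = ≤-trans (≤-reflexive (sym (sum-zero {suc m} _ (λ _ → sum-zero {suc m} _ (λ _ → refl)))))
  (sum₂-mono-≤ {f = λ _ _ → 0ℤ} {g = λ x y → + ∣ cross s x y ∣} (λ x y → +≤+ z≤n))

descent-or-rotation : ∀ {m} (s : Winding m) →
  (∃[ i ] cross s (at s i) (at s (next i)) < 0ℤ) ⊎ (∃[ r ] (∀ p → at s p ≡ rotU r p))
descent-or-rotation s = decide (Fin.any? (λ i → cross s (at s i) (at s (next i)) ℤ.<? 0ℤ))
  where
  decide : Dec (∃[ i ] cross s (at s i) (at s (next i)) < 0ℤ) →
    (∃[ i ] cross s (at s i) (at s (next i)) < 0ℤ) ⊎ (∃[ r ] (∀ p → at s p ≡ rotU r p))
  decide (yes descent) = inj₁ descent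
  decide (no none) = inj₂ (sorted⇒rotation s (λ i → ≮⇒≥ (λ c<0 → none (i , c<0))))

within-rotation : ∀ {m} k (s : Winding m) → (∃[ r ] (∀ p → at s p ≡ rotU r p)) → Within k (at s)
within-rotation k s rotation = [] , z≤n , rotation

within-swap : ∀ {m} k (s : Winding m) i → Within k (at (swap s i)) → Within (suc k) (at s)
within-swap k s i (is , len , r , rot) = i ∷ is , s≤s len , r , λ p →
  trans (applySwaps-cong is (swapAt≗transpose i (at s)) p) (rot p)

-- Each descent costs one swap and lowers `total` by at least 2. At `k` equal to 0 a descent would
-- make `total` negative, so the state is already a rotation.
within-total : ∀ {m} k (s : Winding m) → total s ≤ᶻ + 2 * + k → Within k (at s)
within-total {m} zero s t≤0 = [ (λ (i , c<0) → contradiction (absurd i c<0) λ { (+≤+ ()) }) , within-rotation 0 s ]′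
  (descent-or-rotation s)
  where
  absurd : ∀ i → cross s (at s i) (at s (next i)) < 0ℤ → + 2 ≤ᶻ 0ℤ
  absurd i c<0 = ≤-trans (+-monoˡ-≤ (+ 2) (0≤total (swap s i))) (≤-trans (total-swap-descent s i c<0) t≤0)
within-total {m} (suc k) s t≤ =
  [ (λ (i , c<0) → within-swap k s i (within-total k (swap s i)
      (≤-by-difference (≤-trans (total-swap-descent s i c<0) t≤) (ring (total (swap s i)) (+ k)))))
  , within-rotation (suc k) s ]′
  (descent-or-rotation s)
  where
  ring : ∀ a k → + 2 * (1ℤ + k) - (a + + 2) ≡ + 2 * k - a
  ring = solve-∀

-- Upper bound: counting alignments by excedances.

excedance : ℕ → ℕ → ℤ
excedance a A = 𝟙 (a <? A)

-- With arcs a → A and b → B, this is plus or minus the indicator that the arc of b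
-- passes over the start (if a < A) or the end (if A ≤ a) of the arc of a.  As many
-- arcs pass over any cut to the right as to the left, so the sum over b vanishes.
gain : ℕ → ℕ → ℕ → ℕ → ℤ
gain a A b B = excedance a A * (𝟙 (b ≤? a) - 𝟙 (B ≤? a)) - (1ℤ - excedance a A) * (𝟙 (b <? A) - 𝟙 (B <? A))

-- Indicator that exactly one of the two arcs is an excedance.
mix : ℕ → ℕ → ℕ → ℕ → ℤ
mix a A b B = excedance a A * (1ℤ - excedance b B) + (1ℤ - excedance a A) * excedance b B

-- The value of `cross` in `excedanceWinding`, where excedances have lift -1 and all other labels
-- lift 0.
crossing : ℕ → ℕ → ℕ → ℕ → ℤ
crossing a A b B = - excedance a A - - excedance b B + (𝟙 (B <? A) - 𝟙 (b <? a))

-- The left-hand side is 1 if the arcs are aligned (nested with the same direction,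
-- or disjoint with opposite directions) and 0 otherwise.
Alignment : ℕ → ℕ → ℕ → ℕ → Set
Alignment a A b B = + ∣ crossing a A b B ∣ ≤ᶻ mix a A b B + (gain a A b B + gain b B a A)

-- The left side is 1 only if the arc of `b` is nested in that of `a`. Then the arc of `a` passes
-- over the start of the other, and `gain b B a A` is 1.
excedances : ∀ {a A b B} → a ℕ.< A → b ℕ.< B → a ℕ.< b → A ≢ B → Alignment a A b B
excedances {a} {A} {b} {B} a<A b<B a<b A≢B
  rewrite 𝟙-true (a <? A) a<A | 𝟙-true (b <? B) b<B
  | 𝟙-false (b <? a) (ℕ.<-asym a<b) | 𝟙-false (b ≤? a) (ℕ.<⇒≱ a<b) | 𝟙-true (a ≤? b) (ℕ.<⇒≤ a<b)
  | 𝟙-false (B ≤? a) (ℕ.<⇒≱ (ℕ.<-trans a<b b<B)) with B <? A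
... | no _ with A ≤? b
...   | yes _ = +≤+ z≤n
...   | no _ = +≤+ z≤n
excedances {a} {A} {b} {B} a<A b<B a<b A≢B | yes B<A
  rewrite 𝟙-false (A ≤? b) (ℕ.<⇒≱ (ℕ.<-trans b<B B<A)) = +≤+ (s≤s z≤n)

-- Here the nested arc is that of `a`: the arc of `b` passes over its end `A`, and `gain a A b B` is
-- 1.
nonexcedances : ∀ {a A b B} → ¬ a ℕ.< A → ¬ b ℕ.< B → a ℕ.< b → A ≢ B → Alignment a A b B
nonexcedances {a} {A} {b} {B} a≮A b≮B a<b A≢B
  rewrite 𝟙-false (a <? A) a≮A | 𝟙-false (b <? B) b≮B
  | 𝟙-false (b <? a) (ℕ.<-asym a<b) | 𝟙-false (b <? A) (ℕ.<-asym (ℕ.≤-<-trans (ℕ.≮⇒≥ a≮A) a<b)) with B <? A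
... | yes B<A
  rewrite 𝟙-false (A <? B) (ℕ.<-asym B<A) | 𝟙-false (a <? B) (ℕ.<-asym (ℕ.<-≤-trans B<A (ℕ.≮⇒≥ a≮A))) = +≤+ (s≤s z≤n)
... | no B≮A
  rewrite 𝟙-true (A <? B) (ℕ.≤∧≢⇒< (ℕ.≮⇒≥ B≮A) A≢B) with a <? B
...   | yes _ = +≤+ z≤n
...   | no _  = +≤+ z≤n

-- `mix` is 1, which suffices for disjoint arcs, where both gains are 0. For overlapping arcs
-- exactly one gain is -1: the arc of `b` passes over the start of the other if `B ≤ a`, and the arc
-- of `a` passes over the end `B` if `a < B`.
opposite-excedances : ∀ {a A b B} → a ℕ.< A → ¬ b ℕ.< B → a ≢ b → A ≢ B → Alignment a A b B
opposite-excedances {a} {A} {b} {B} a<A b≮B a≢b A≢B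
  rewrite 𝟙-true (a <? A) a<A | 𝟙-false (b <? B) b≮B with b <? a | B <? A
... | yes b<a | yes B<A
  rewrite 𝟙-true (b ≤? a) (ℕ.<⇒≤ b<a) | 𝟙-false (A <? B) (ℕ.<-asym B<A)
  | 𝟙-true (B ≤? a) (ℕ.<⇒≤ (ℕ.≤-<-trans (ℕ.≮⇒≥ b≮B) b<a))
  | 𝟙-false (a <? B) (ℕ.<-asym (ℕ.≤-<-trans (ℕ.≮⇒≥ b≮B) b<a)) = +≤+ (s≤s z≤n)
... | yes b<a | no B≮A = contradiction
  (ℕ.<-≤-trans a<A (ℕ.≤-trans (ℕ.≮⇒≥ B≮A) (ℕ.≮⇒≥ b≮B))) (ℕ.<-asym b<a)
... | no b≮a | yes B<A
  rewrite 𝟙-false (b ≤? a) (λ b≤a → b≮a (ℕ.≤∧≢⇒< b≤a (a≢b ∘ sym)))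
  | 𝟙-false (A <? B) (ℕ.<-asym B<A) with a <? B
...   | yes a<B rewrite 𝟙-false (B ≤? a) (ℕ.<⇒≱ a<B) = +≤+ z≤n
...   | no a≮B rewrite 𝟙-true (B ≤? a) (ℕ.≮⇒≥ a≮B) = +≤+ z≤n
opposite-excedances {a} {A} {b} {B} a<A b≮B a≢b A≢B | no b≮a | no B≮A
  rewrite 𝟙-false (b ≤? a) (λ b≤a → b≮a (ℕ.≤∧≢⇒< b≤a (a≢b ∘ sym)))
  | 𝟙-true (A <? B) (ℕ.≤∧≢⇒< (ℕ.≮⇒≥ B≮A) A≢B)
  | 𝟙-true (a <? B) (ℕ.<-≤-trans a<A (ℕ.≮⇒≥ B≮A))
  | 𝟙-false (B ≤? a) (ℕ.<⇒≱ (ℕ.<-≤-trans a<A (ℕ.≮⇒≥ B≮A))) = +≤+ (s≤s z≤n)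

0≤i*i : ∀ i → 0ℤ ≤ᶻ i * i
0≤i*i (+ zero) = ≤-refl
0≤i*i (+ suc k) = +≤+ z≤n
0≤i*i -[1+ k ] = +≤+ z≤n

module _ {m : ℕ} (π : Permutation′ (suc m)) where

  private
    N : ℤ
    N = + suc m

    P : Fin (suc m) → ℕ
    P x = toℕ (π ⟨$⟩ˡ x)

    χ : Fin (suc m) → ℤ
    χ x = excedance (toℕ x) (P x)

    g μ : Fin (suc m) → Fin (suc m) → ℤ
    g x y = gain (toℕ x) (P x) (toℕ y) (P y)
    μ x y = mix (toℕ x) (P x) (toℕ y) (P y)

    e : ℤ
    e = sum χ

  excedanceWinding : Winding m
  excedanceWinding = winding π (-_ ∘ χ)

  private
    s : Winding m
    s = excedanceWinding

    sum-gain : ∀ x → sum (g x) ≡ 0ℤ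
    sum-gain x = trans (sum-cong-≗ (λ y → ring (χ x) (𝟙 (toℕ y ≤? toℕ x)) (𝟙 (P y ≤? toℕ x)) (𝟙 (toℕ y <? P x)) (𝟙 (P y <? P x))))
      (sum-rearrange (λ y → χ x * 𝟙 (toℕ y ≤? toℕ x) - (1ℤ - χ x) * 𝟙 (toℕ y <? P x)) π)
      where
      ring : ∀ e a b c d → e * (a - b) - (1ℤ - e) * (c - d) ≡ e * a - (1ℤ - e) * c - (e * b - (1ℤ - e) * d)
      ring = solve-∀

    sum-nonexcedance : sum (λ y → 1ℤ - χ y) ≡ N - e
    sum-nonexcedance = trans (sum-distrib-- (λ _ → 1ℤ) χ)
      (cong (_- e) (trans (sum-const (suc m) 1ℤ) (*-identityʳ N)))

    sum₂-μ : sum₂ μ ≡ e * (N - e) + (N - e) * e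
    sum₂-μ = trans (sum₂-distrib-+ (λ x y → χ x * (1ℤ - χ y)) (λ x y → (1ℤ - χ x) * χ y))
      (cong₂ _+_ (trans (sum₂-* χ (λ y → 1ℤ - χ y)) (cong (e *_) sum-nonexcedance))
        (trans (sum₂-* (λ x → 1ℤ - χ x) χ) (cong (_* e) sum-nonexcedance)))

    sum₂-diagonal : sum₂ (λ x y → δ y x * (+ 2 * χ x)) ≡ + 2 * e
    sum₂-diagonal = trans (sum-cong-≗ (λ x → trans (sym (*-distribʳ-sum (+ 2 * χ x) (λ y → δ y x)))
        (trans (cong (_* (+ 2 * χ x)) (sum-δ x)) (*-identityˡ (+ 2 * χ x)))))
      (sym (*-distribˡ-sum (+ 2) χ))

    align-< : ∀ x y → toℕ x ℕ.< toℕ y → Alignment (toℕ x) (P x) (toℕ y) (P y)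
    align-flip : ∀ x y → Alignment (toℕ x) (P x) (toℕ y) (P y) → Alignment (toℕ y) (P y) (toℕ x) (P x)
    align-flip x y = subst₂ _≤ᶻ_
      (cong +_ (trans (sym (∣-i∣≡∣i∣ (cross s x y))) (cong ∣_∣ (sym (cross-antisym s x y)))))
      (ring (χ x) (χ y) (g x y) (g y x))
      where
      ring : ∀ a b c d → a * (1ℤ - b) + (1ℤ - a) * b + (c + d) ≡ b * (1ℤ - a) + (1ℤ - b) * a + (d + c)
      ring = solve-∀
    align-< x y x<y = decide (toℕ x <? P x) (toℕ y <? P y)
      where
      x≢y : x ≢ y
      x≢y refl = ℕ.<-irrefl refl x<y
      Px≢Py : P x ≢ P y
      Px≢Py = toℕ-≢ (x≢y ∘ pos-injective s)
      decide : Dec (toℕ x ℕ.< P x) → Dec (toℕ y ℕ.< P y) → Alignment (toℕ x) (P x) (toℕ y) (P y)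
      decide (yes p) (yes q) = excedances p q x<y Px≢Py
      decide (no p) (no q) = nonexcedances p q x<y Px≢Py
      decide (yes p) (no q) = opposite-excedances p q (toℕ-≢ x≢y) Px≢Py
      decide (no p) (yes q) = align-flip y x (opposite-excedances q p (toℕ-≢ (x≢y ∘ sym)) (Px≢Py ∘ sym))

    -- An excedance passes over its own start, so its gain against itself is 1, while its crossing
    -- number with itself is 0. This surplus of `2 e` improves `e (n - e)` to `e (n - 1 - e)`.
    diagonal : ∀ x → + 2 * χ x ≤ᶻ μ x x + (g x x + g x x)
    diagonal x = decide (toℕ x <? P x)
      where
      decide : Dec (toℕ x ℕ.< P x) → + 2 * χ x ≤ᶻ μ x x + (g x x + g x x)
      decide (yes p) rewrite 𝟙-true (toℕ x <? P x) p | 𝟙-true (toℕ x ≤? toℕ x) ℕ.≤-refl | 𝟙-false (P x ≤? toℕ x) (ℕ.<⇒≱ p) = ≤-refl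
      decide (no p) rewrite 𝟙-false (toℕ x <? P x) p | 𝟙-false (P x <? P x) (ℕ.<-irrefl refl) = ≤-refl

    pointwise : ∀ x y → + ∣ cross s x y ∣ + δ y x * (+ 2 * χ x) ≤ᶻ μ x y + (g x y + g y x)
    pointwise x y with y ≟ x
    ... | yes refl = ≤-trans (≤-reflexive (trans (cong₂ (λ a b → + ∣ a ∣ + b) (cross-irrefl s x) (*-identityˡ (+ 2 * χ x))) (+-identityˡ _))) (diagonal x)
    ... | no y≢x = ≤-trans (≤-reflexive (+-identityʳ _)) (align (ℕ.<-cmp (toℕ x) (toℕ y)))
      where
      align : Tri (toℕ x ℕ.< toℕ y) (toℕ x ≡ toℕ y) (toℕ y ℕ.< toℕ x) → Alignment (toℕ x) (P x) (toℕ y) (P y)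
      align (tri< x<y _ _) = align-< x y x<y
      align (tri≈ _ x≡y _) = contradiction (Fin.toℕ-injective (sym x≡y)) y≢x
      align (tri> _ _ y<x) = align-flip y x (align-< y x y<x)

  total-excedanceWinding : total s ≤ᶻ + 2 * (e * (+ m - e))
  total-excedanceWinding = ≤-by-difference (subst₂ _≤ᶻ_ lhs rhs (sum₂-mono-≤ pointwise)) (ring (total s) e (+ m))
    where
    lhs : sum₂ (λ x y → + ∣ cross s x y ∣ + δ y x * (+ 2 * χ x)) ≡ total s + + 2 * e
    lhs = trans (sum₂-distrib-+ (λ x y → + ∣ cross s x y ∣) (λ x y → δ y x * (+ 2 * χ x))) (cong (_+_ (total s)) sum₂-diagonal)
    rhs : sum₂ (λ x y → μ x y + (g x y + g y x)) ≡ e * (N - e) + (N - e) * e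
    rhs = trans (sum₂-distrib-+ μ (λ x y → g x y + g y x)) (trans (cong₂ _+_ sum₂-μ
      (trans (sum₂-distrib-+ g (λ x y → g y x)) (cong₂ _+_ (sum-zero (sum ∘ g) sum-gain) (trans (∑-comm (λ x y → g y x)) (sum-zero (sum ∘ g) sum-gain)))))
      (+-identityʳ _))
    ring : ∀ t e m → e * (1ℤ + m - e) + (1ℤ + m - e) * e - (t + + 2 * e) ≡ + 2 * (e * (m - e)) - t
    ring = solve-∀

  -- Since `(m - 2 e)²` is nonnegative, four times the left side is at most `m²`.
  excedances-≤-bound : e * (+ m - e) ≤ᶻ + bound (suc m)
  excedances-≤-bound = quarter (e * (+ m - e)) (m ℕ.* m) (≤-by-difference (0≤i*i (+ m - + 2 * e))
    (trans (ring (+ m) e) (cong (_- + 4 * (e * (+ m - e))) (sym (pos-* m m)))))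
    where
    ring : ∀ m e → (m - + 2 * e) * (m - + 2 * e) - 0ℤ ≡ m * m - + 4 * (e * (m - e))
    ring = solve-∀
    quarter : ∀ i k → + 4 * i ≤ᶻ + k → i ≤ᶻ + (k ℕ./ 4)
    quarter (+ i) k 4i≤k = +≤+ (subst (ℕ._≤ k ℕ./ 4) (ℕ.m*n/n≡m i 4)
      (ℕ./-monoˡ-≤ 4 (drop‿+≤+ (subst (_≤ᶻ + k) (trans (*-comm (+ 4) (+ i)) (sym (pos-* i 4))) 4i≤k))))
    quarter -[1+ _ ] k _ = -≤+

  within-bound : Within (bound (suc m)) (π ⟨$⟩ʳ_)
  within-bound = within-total (bound (suc m)) s
    (≤-trans total-excedanceWinding (*-monoˡ-≤-nonNeg (+ 2) excedances-≤-bound))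

-- Lower bound: the reversed arrangement.

-- Swaps act on positions regardless of the labels, so a single winding state follows them for every
-- labelling `f`.
trackSwaps : ∀ {m} (is : List (Fin (suc m))) (s : Winding m) → ∃[ t ]
  (∀ (f : Arrangement (suc m)) p → applySwaps is (f ∘ at s) p ≡ f (at t p)) ×
  total t ≤ᶻ total s + + 2 * + length is
trackSwaps [] s = s , (λ f p → refl) , ≤-reflexive (sym (+-identityʳ (total s)))
trackSwaps (i ∷ is) s with trackSwaps is (swap s i)
... | t , carried , total≤ = t
  , (λ f p → trans (applySwaps-cong is (swapAt≗transpose i (f ∘ at s)) p) (carried f p))
  , ≤-trans total≤ (≤-trans (+-monoˡ-≤ (+ 2 * + length is) (total-swap-≤ s i))
      (≤-reflexive (ring (total s) (+ length is))))
  where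
  ring : ∀ t l → t + + 2 + + 2 * l ≡ t + + 2 * (1ℤ + l)
  ring = solve-∀

lift-gap : ∀ {a b h k} d n → a ℕ.+ k ℕ.* n ≡ b ℕ.+ h ℕ.* n → h ℕ.+ d ℕ.≤ k → a ℕ.+ d ℕ.* n ℕ.≤ b
lift-gap {a} {b} {h} {k} d n e h+d≤k = ℕ.+-cancelʳ-≤ (h ℕ.* n) (a ℕ.+ d ℕ.* n) b (begin
  a ℕ.+ d ℕ.* n ℕ.+ h ℕ.* n ≡⟨ ℕ.+-assoc a (d ℕ.* n) (h ℕ.* n) ⟩
  a ℕ.+ (d ℕ.* n ℕ.+ h ℕ.* n) ≡⟨ cong (a ℕ.+_) (ℕ.*-distribʳ-+ n d h) ⟨
  a ℕ.+ (d ℕ.+ h) ℕ.* n ≤⟨ ℕ.+-monoʳ-≤ a (ℕ.*-monoˡ-≤ n (subst (ℕ._≤ k) (ℕ.+-comm h d) h+d≤k)) ⟩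
  a ℕ.+ k ℕ.* n ≡⟨ e ⟩
  b ℕ.+ h ℕ.* n ∎)
  where open ℕ.≤-Reasoning

-- Two elements at a < b, reversed and rotated to A and B, with h and k
-- counting the wrap-arounds of the rotation.
reversed-order : ∀ {a A b B h k n} → A ℕ.+ a ℕ.+ k ℕ.* n ≡ B ℕ.+ b ℕ.+ h ℕ.* n →
  a ℕ.< b → b ℕ.< n → A ℕ.< n → B ℕ.< n → 𝟙 (B <? A) ≡ 1ℤ + (+ h - + k)
reversed-order {a} {A} {b} {B} {h} {k} {n} e a<b b<n A<n B<n with B <? A
-- Here `h` equals `k`: if they differed, the two sums of position and label would be at least `n`
-- apart, in a direction or to an extent that the bounds exclude.
... | yes B<A = sym (cong (λ z → 1ℤ + z) (i≡j⇒i-j≡0 (cong +_ (ℕ.≤-antisym (ℕ.≮⇒≥ k≮h) (ℕ.≮⇒≥ h≮k)))))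
  where
  open ℕ.≤-Reasoning
  h≮k : ¬ h ℕ.< k
  h≮k h<k = ℕ.<-irrefl refl (begin-strict
    B ℕ.+ b <⟨ ℕ.+-mono-< B<A b<n ⟩
    A ℕ.+ n ≤⟨ ℕ.+-monoˡ-≤ n (ℕ.m≤m+n A a) ⟩
    A ℕ.+ a ℕ.+ n ≡⟨ cong (A ℕ.+ a ℕ.+_) (ℕ.*-identityˡ n) ⟨
    A ℕ.+ a ℕ.+ 1 ℕ.* n ≤⟨ lift-gap 1 n e (subst (ℕ._≤ k) (ℕ.+-comm 1 h) h<k) ⟩
    B ℕ.+ b ∎)
  k≮h : ¬ k ℕ.< h
  k≮h k<h = ℕ.<-irrefl refl (begin-strict
    A ℕ.+ a <⟨ ℕ.+-mono-< A<n a<b ⟩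
    n ℕ.+ b ≤⟨ ℕ.m≤n+m (n ℕ.+ b) B ⟩
    B ℕ.+ (n ℕ.+ b) ≡⟨ cong (B ℕ.+_) (ℕ.+-comm n b) ⟩
    B ℕ.+ (b ℕ.+ n) ≡⟨ ℕ.+-assoc B b n ⟨
    B ℕ.+ b ℕ.+ n ≡⟨ cong (B ℕ.+ b ℕ.+_) (ℕ.*-identityˡ n) ⟨
    B ℕ.+ b ℕ.+ 1 ℕ.* n ≤⟨ lift-gap 1 n (sym e) (subst (ℕ._≤ h) (ℕ.+-comm 1 k) k<h) ⟩
    A ℕ.+ a ∎)
-- Here `k` equals `h + 1`: `A + a < B + b` forces `h < k`, and `k ≥ h + 2` would need
-- `B + b ≥ 2 n`.
... | no B≮A = trans (ring (+ h)) (cong (λ k → 1ℤ + (+ h - + k)) (ℕ.≤-antisym (ℕ.≰⇒> k≰h) (ℕ.≮⇒≥ 1+h≮k)))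
  where
  open ℕ.≤-Reasoning
  ring : ∀ h → 0ℤ ≡ 1ℤ + (h - (1ℤ + h))
  ring = solve-∀
  k≰h : ¬ k ℕ.≤ h
  k≰h k≤h = ℕ.<-irrefl refl (begin-strict
    A ℕ.+ a <⟨ ℕ.+-mono-≤-< (ℕ.≮⇒≥ B≮A) a<b ⟩
    B ℕ.+ b ≡⟨ ℕ.+-identityʳ (B ℕ.+ b) ⟨
    B ℕ.+ b ℕ.+ 0 ℕ.* n ≤⟨ lift-gap 0 n (sym e) (subst (ℕ._≤ h) (sym (ℕ.+-identityʳ k)) k≤h) ⟩
    A ℕ.+ a ∎)
  1+h≮k : ¬ suc h ℕ.< k
  1+h≮k 1+h<k = ℕ.<-irrefl refl (begin-strict
    B ℕ.+ b <⟨ ℕ.+-mono-< B<n b<n ⟩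
    n ℕ.+ n ≡⟨ cong (n ℕ.+_) (ℕ.+-identityʳ n) ⟨
    2 ℕ.* n ≤⟨ ℕ.m≤n+m (2 ℕ.* n) (A ℕ.+ a) ⟩
    A ℕ.+ a ℕ.+ 2 ℕ.* n ≤⟨ lift-gap 2 n e (subst (ℕ._≤ k) (ℕ.+-comm 2 h) 1+h<k) ⟩
    B ℕ.+ b ∎)

parity : ℤ → ℤ
parity i = (- 1ℤ) ^ ∣ i ∣

parity-suc : ∀ i → parity (1ℤ + i) ≡ - parity i
parity-suc (+ n) = -1*i≡-i (parity (+ n))
parity-suc -[1+ zero ] = refl
parity-suc -[1+ suc n ] = trans (sym (neg-involutive (parity -[1+ n ]))) (cong -_ (sym (-1*i≡-i (parity -[1+ n ]))))

parity-±1 : ∀ i → parity i ≡ 1ℤ ⊎ parity i ≡ - 1ℤ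
parity-±1 i = power ∣ i ∣
  where
  power : ∀ n → (- 1ℤ) ^ n ≡ 1ℤ ⊎ (- 1ℤ) ^ n ≡ - 1ℤ
  power zero = inj₁ refl
  power (suc n) with power n
  ... | inj₁ e = inj₂ (cong (- 1ℤ *_) e)
  ... | inj₂ e = inj₁ (cong (- 1ℤ *_) e)

-- The left-hand side is 2 if i and j have the same parity, in which case 1 + (i - j)
-- is odd, and 0 otherwise.
parity-≤ : ∀ i j → 1ℤ + parity i * parity j ≤ᶻ + 2 * + ∣ 1ℤ + (i - j) ∣
parity-≤ i j with ∣ 1ℤ + (i - j) ∣ in eq
-- In this case `j` is `1ℤ + i`, so the parities are opposite and the left side is 0.
... | zero = ≤-reflexive (trans (cong (λ p → 1ℤ + parity i * p)
    (trans (cong parity (trans (ring i j) (trans (cong (λ z → 1ℤ + i - z) (∣i∣≡0⇒i≡0 eq)) (+-identityʳ (1ℤ + i))))) (parity-suc i)))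
  (opposite (parity-±1 i)))
  where
  ring : ∀ i j → j ≡ 1ℤ + i - (1ℤ + (i - j))
  ring = solve-∀
  opposite : ∀ {p} → p ≡ 1ℤ ⊎ p ≡ - 1ℤ → 1ℤ + p * - p ≡ 0ℤ
  opposite (inj₁ refl) = refl
  opposite (inj₂ refl) = refl
... | suc d = ≤-trans (small (parity-±1 i) (parity-±1 j)) (*-monoˡ-≤-nonNeg (+ 2) {1ℤ} {+ suc d} (+≤+ (s≤s z≤n)))
  where
  small : ∀ {p q} → p ≡ 1ℤ ⊎ p ≡ - 1ℤ → q ≡ 1ℤ ⊎ q ≡ - 1ℤ → 1ℤ + p * q ≤ᶻ + 2
  small (inj₁ refl) (inj₁ refl) = ≤-refl
  small (inj₁ refl) (inj₂ refl) = +≤+ z≤n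
  small (inj₂ refl) (inj₁ refl) = +≤+ z≤n
  small (inj₂ refl) (inj₂ refl) = ≤-refl

module _ {m : ℕ} (s : Winding m) (r : ℕ) (reversed : ∀ x → Fin.opposite x ≡ rotU r (pos s x)) where

  private
    n : ℕ
    n = suc m

    h : Fin n → ℕ
    h x = (toℕ (pos s x) ℕ.+ r) ℕ./ n

    -- `z x` adds to the lift the number of times the rotation by `r` carries `x` over the cut; the
    -- sign `σ x` of its parity defines the two classes.
    z σ : Fin n → ℤ
    z x = lift s x + + h x
    σ x = parity (z x)

    -- A label and its opposite sum to `m`, so position plus label is constant up to multiples of
    -- `n`.
    position : ∀ x → toℕ (pos s x) ℕ.+ toℕ x ℕ.+ r ≡ m ℕ.+ h x ℕ.* n
    position x = begin
      A ℕ.+ a ℕ.+ r ≡⟨ ℕ.+-assoc A a r ⟩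
      A ℕ.+ (a ℕ.+ r) ≡⟨ cong (A ℕ.+_) (ℕ.+-comm a r) ⟩
      A ℕ.+ (r ℕ.+ a) ≡⟨ ℕ.+-assoc A r a ⟨
      A ℕ.+ r ℕ.+ a ≡⟨ cong (ℕ._+ a) (ℕ.m≡m%n+[m/n]*n (A ℕ.+ r) n) ⟩
      (A ℕ.+ r) ℕ.% n ℕ.+ h x ℕ.* n ℕ.+ a ≡⟨ cong (λ k → k ℕ.+ h x ℕ.* n ℕ.+ a) (Fin.toℕ-fromℕ< (ℕ.m%n<n (A ℕ.+ r) n)) ⟨
      toℕ (rotU r (pos s x)) ℕ.+ h x ℕ.* n ℕ.+ a ≡⟨ cong (λ k → toℕ k ℕ.+ h x ℕ.* n ℕ.+ a) (reversed x) ⟨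
      toℕ (Fin.opposite x) ℕ.+ h x ℕ.* n ℕ.+ a ≡⟨ cong (λ k → k ℕ.+ h x ℕ.* n ℕ.+ a) (Fin.opposite-prop x) ⟩
      m ℕ.∸ a ℕ.+ h x ℕ.* n ℕ.+ a ≡⟨ ℕ.+-assoc (m ℕ.∸ a) _ a ⟩
      m ℕ.∸ a ℕ.+ (h x ℕ.* n ℕ.+ a) ≡⟨ cong (m ℕ.∸ a ℕ.+_) (ℕ.+-comm (h x ℕ.* n) a) ⟩
      m ℕ.∸ a ℕ.+ (a ℕ.+ h x ℕ.* n) ≡⟨ ℕ.+-assoc (m ℕ.∸ a) a _ ⟨
      m ℕ.∸ a ℕ.+ a ℕ.+ h x ℕ.* n ≡⟨ cong (ℕ._+ h x ℕ.* n) (ℕ.m∸n+n≡m (Fin.toℕ≤pred[n] x)) ⟩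
      m ℕ.+ h x ℕ.* n ∎
      where
      open ≡-Reasoning
      a A : ℕ
      a = toℕ x
      A = toℕ (pos s x)

    positions : ∀ x y → toℕ (pos s x) ℕ.+ toℕ x ℕ.+ h y ℕ.* n ≡ toℕ (pos s y) ℕ.+ toℕ y ℕ.+ h x ℕ.* n
    positions x y = ℕ.+-cancelʳ-≡ (r ℕ.+ m) _ _ (begin
      a ℕ.+ h y ℕ.* n ℕ.+ (r ℕ.+ m) ≡⟨ ring a (h y ℕ.* n) r m ⟩
      a ℕ.+ r ℕ.+ (m ℕ.+ h y ℕ.* n) ≡⟨ cong₂ ℕ._+_ (position x) (sym (position y)) ⟩
      m ℕ.+ h x ℕ.* n ℕ.+ (b ℕ.+ r) ≡⟨ ring′ b (h x ℕ.* n) r m ⟩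
      b ℕ.+ h x ℕ.* n ℕ.+ (r ℕ.+ m) ∎)
      where
      open ≡-Reasoning
      a b : ℕ
      a = toℕ (pos s x) ℕ.+ toℕ x
      b = toℕ (pos s y) ℕ.+ toℕ y
      ring : ∀ a h r m → a ℕ.+ h ℕ.+ (r ℕ.+ m) ≡ a ℕ.+ r ℕ.+ (m ℕ.+ h)
      ring = ℕ-Solver.solve-∀
      ring′ : ∀ b h r m → m ℕ.+ h ℕ.+ (b ℕ.+ r) ≡ b ℕ.+ h ℕ.+ (r ℕ.+ m)
      ring′ = ℕ-Solver.solve-∀

    cross-< : ∀ x y → toℕ x ℕ.< toℕ y → cross s x y ≡ 1ℤ + (z x - z y)
    cross-< x y x<y = trans (cong₂ (λ a b → lift s x - lift s y + (a - b))
        (reversed-order {h = h x} {k = h y} (positions x y) x<y (Fin.toℕ<n y) (Fin.toℕ<n (pos s x)) (Fin.toℕ<n (pos s y)))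
        (𝟙-false (y Fin.<? x) (ℕ.<-asym x<y)))
      (ring (lift s x) (lift s y) (+ h x) (+ h y))
      where
      ring : ∀ a b c d → a - b + (1ℤ + (c - d) - 0ℤ) ≡ 1ℤ + (a + c - (b + d))
      ring = solve-∀

    off-diagonal : ∀ x y → toℕ x ℕ.< toℕ y → 1ℤ + σ x * σ y ≤ᶻ + 2 * + ∣ cross s x y ∣
    off-diagonal x y x<y = subst (λ c → 1ℤ + σ x * σ y ≤ᶻ + 2 * + ∣ c ∣) (sym (cross-< x y x<y)) (parity-≤ (z x) (z y))

    pointwise : ∀ x y → 1ℤ + σ x * σ y ≤ᶻ + 2 * + ∣ cross s x y ∣ + δ y x * + 2
    pointwise x y with y ≟ x
    ... | yes refl = ≤-trans (≤-reflexive (square (parity-±1 (z x)))) (i≤j+i (+ 2) (+ 2 * + ∣ cross s x x ∣) {{nonneg ∣ cross s x x ∣}})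
      where
      square : ∀ {p} → p ≡ 1ℤ ⊎ p ≡ - 1ℤ → 1ℤ + p * p ≡ + 2
      square (inj₁ refl) = refl
      square (inj₂ refl) = refl
      nonneg : ∀ k → NonNegative (+ 2 * + k)
      nonneg zero = _
      nonneg (suc k) = _
    ... | no y≢x = ≤-trans (apart (ℕ.<-cmp (toℕ x) (toℕ y))) (≤-reflexive (sym (+-identityʳ _)))
      where
      apart : Tri (toℕ x ℕ.< toℕ y) (toℕ x ≡ toℕ y) (toℕ y ℕ.< toℕ x) → 1ℤ + σ x * σ y ≤ᶻ + 2 * + ∣ cross s x y ∣
      apart (tri< x<y _ _) = off-diagonal x y x<y
      apart (tri≈ _ x≡y _) = contradiction (Fin.toℕ-injective (sym x≡y)) y≢x
      apart (tri> _ _ y<x) = subst₂ _≤ᶻ_ (cong (_+_ 1ℤ) (*-comm (σ y) (σ x)))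
        (cong (λ k → + 2 * + k) (trans (cong ∣_∣ (cross-antisym s x y)) (∣-i∣≡∣i∣ (cross s x y))))
        (off-diagonal y x y<x)

  -- Summing `pointwise` leaves `n² + (sum σ)²` on the left, and the square is dropped. The term
  -- `+ n * + 2` pays for the diagonal, where `1ℤ + σ x * σ x` is 2.
  total-reversed : + n * + n ≤ᶻ + 2 * total s + + n * + 2
  total-reversed = ≤-trans (≤-by-difference (0≤i*i (sum σ)) (ring (+ n * + n) (sum σ * sum σ)))
    (subst₂ _≤ᶻ_ lhs rhs (sum₂-mono-≤ pointwise))
    where
    ring : ∀ a b → b - 0ℤ ≡ a + b - a
    ring = solve-∀
    lhs : sum₂ (λ x y → 1ℤ + σ x * σ y) ≡ + n * + n + sum σ * sum σ
    lhs = trans (sum₂-distrib-+ {n} (λ x y → 1ℤ) (λ x y → σ x * σ y)) (cong₂ _+_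
      (trans (sum-cong-≗ {n} (λ _ → trans (sum-const n 1ℤ) (*-identityʳ (+ n)))) (sum-const n (+ n)))
      (sum₂-* σ σ))
    rhs : sum₂ (λ x y → + 2 * + ∣ cross s x y ∣ + δ y x * + 2) ≡ + 2 * total s + + n * + 2
    rhs = trans (sum₂-distrib-+ (λ x y → + 2 * + ∣ cross s x y ∣) (λ x y → δ y x * + 2)) (cong₂ _+_
      (trans (sum-cong-≗ (λ x → sym (*-distribˡ-sum (+ 2) (λ y → + ∣ cross s x y ∣)))) (sym (*-distribˡ-sum (+ 2) (λ x → sum (λ y → + ∣ cross s x y ∣)))))
      (trans (sum-cong-≗ {n} (λ x → trans (sym (*-distribʳ-sum (+ 2) (λ y → δ y x))) (cong (_* + 2) (sum-δ x)))) (sum-const n (+ 2))))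

still : ∀ m → Winding m
still m = winding id (λ _ → 0ℤ)

total-still : ∀ m → total (still m) ≡ 0ℤ
total-still m = sum-zero {suc m} _ (λ x → sum-zero {suc m} _ (λ y → cong (λ c → + ∣ 0ℤ + c ∣) (+-inverseʳ (x ≻ y))))

-- The reversed arrangement is `Fin.opposite` on the state `still m`, whose total is 0, so
-- `trackSwaps` bounds the final total by `2 k` and `total-reversed` bounds it from below.
bound-≤ : ∀ {m} k → Within k (reverse {suc m} ⟨$⟩ʳ_) → bound (suc m) ℕ.≤ k
bound-≤ {m} k (is , len≤k , r , rot) with trackSwaps is (still m)
-- The estimate `m² ≤ 1 + 4 k` is enough: rounding down in `bound` absorbs the excess, as
-- `1 + 4 k < 4 (k + 1)`.
... | s , carried , total≤ = ℕ.s≤s⁻¹ (ℕ.m<n*o⇒m/o<n {m ℕ.* m} {suc k} {4} (ℕ.<-≤-trans (s≤s m*m≤1+k*4) (ℕ.+-monoˡ-≤ (k ℕ.* 4) (s≤s (s≤s z≤n)))))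
  where
  reversed : ∀ x → Fin.opposite x ≡ rotU r (pos s x)
  reversed x = trans (cong Fin.opposite (sym (inverseʳ (perm s))))
    (trans (sym (carried Fin.opposite (pos s x))) (rot (pos s x)))
  total≤2k : total s ≤ᶻ + 2 * + k
  total≤2k = ≤-trans total≤ (≤-trans (≤-reflexive (trans (cong (_+ + 2 * + length is) (total-still m)) (+-identityˡ _)))
    (*-monoˡ-≤-nonNeg (+ 2) (+≤+ len≤k)))
  m*m≤1+k*4 : m ℕ.* m ℕ.≤ 1 ℕ.+ k ℕ.* 4
  m*m≤1+k*4 = drop‿+≤+ (subst₂ _≤ᶻ_ (sym (pos-* m m)) (cong (_+_ 1ℤ) (sym (pos-* k 4)))
    (≤-by-difference (≤-trans (total-reversed s r reversed) (+-monoˡ-≤ (+ suc m * + 2) (*-monoˡ-≤-nonNeg (+ 2) total≤2k)))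
      (ring (+ m) (+ k))))
    where
    ring : ∀ m k → + 2 * (+ 2 * k) + (1ℤ + m) * + 2 - (1ℤ + m) * (1ℤ + m) ≡ 1ℤ + k * + 4 - m * m
    ring = solve-∀

theorem1p1 : (n : ℕ) .{{_ : NonZero n}} →
    ((π : Permutation′ n) → Within (bound n) (π ⟨$⟩ʳ_)) ×
    Σ (Permutation′ n) (λ π → (k : ℕ) → Within k (π ⟨$⟩ʳ_) → bound n ≤ k)
theorem1p1 zero = contradiction refl (ℕ.≢-nonZero⁻¹ 0)
theorem1p1 (suc m) = within-bound , reverse , bound-≤
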